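{- Let $s\in\mathbb{N}$ and let $t=4w+z$ with $w\in\mathbb{N}$ and $z\in\{0,1,2,3\}$. Then $C_3^tC_4^s$ can be gracefully labelled if $t=4w$ or $t=4w+1$, and can be near gracefully labelled if $t=4w+2$ or $t=4w+3$.
   Context: Here $\mathbb{N}$ includes $0$. $C_n^t$ denotes the union of $t$ cycles of length $n$ sharing exactly one common (central) vertex, and $C_3^tC_4^s$ denotes the graph obtained by identifying the central vertices of $C_3^t$ and $C_4^s$ (a windmill with $t$ triangle vanes and $s$ $4$-cycle vanes). For a graph $G$ with $m$ edges, a graceful labelling is an injective map $f:V(G)\to\{0,\ldots,m\}$ such that $g(uv)=|f(u)-f(v)|$ is a bijection $E(G)\to\{1,\ldots,m\}$. A near graceful labelling is an injective map $f:V(G)\to\{0,\ldots,m+1\}$ such that $g(uv)=|f(u)-f(v)|$ is a bijection onto $\{1,\ldots,m-1,m\}$ or onto $\{1,\ldots,m-1,m+1\}$. -}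

module Defs where

open import Data.Nat using (ℕ; zero; suc; _+_; _*_; _∸_; _≤_; ∣_-_∣)
open import Data.Fin using (Fin; zero; suc)
open import Data.Product using (Σ; ∃; _×_; _,_)
open import Data.Sum using (_⊎_)
open import Relation.Binary.PropositionalEquality using (_≡_)
open import Function.Definitions using (Injective)

-- Vertices of C_3^t C_4^s:
--   centre; for each triangle i < t two further vertices (tri i 0, tri i 1);
--   for each 4-cycle j < s three further vertices (sq j 0, sq j 1, sq j 2).
data Vert (t s : ℕ) : Set where
  centre : Vert t s
  tri    : Fin t → Fin 2 → Vert t s
  sq     : Fin s → Fin 3 → Vert t s

data Edge (t s : ℕ) : Set where
  triE : Fin t → Fin 3 → Edge t s
  sqE  : Fin s → Fin 4 → Edge t s

ends : ∀ {t s} → Edge t s → Vert t s × Vert t s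
ends (triE i zero)                   = centre , tri i zero
ends (triE i (suc zero))             = tri i zero , tri i (suc zero)
ends (triE i (suc (suc zero)))       = tri i (suc zero) , centre
ends (sqE j zero)                    = centre , sq j zero
ends (sqE j (suc zero))              = sq j zero , sq j (suc zero)
ends (sqE j (suc (suc zero)))        = sq j (suc zero) , sq j (suc (suc zero))
ends (sqE j (suc (suc (suc zero))))  = sq j (suc (suc zero)) , centre

edges : ℕ → ℕ → ℕ
edges t s = 3 * t + 4 * s

edgeLabel : ∀ {t s} → (Vert t s → ℕ) → Edge t s → ℕ
edgeLabel f e with ends e
... | u , v = ∣ f u - f v ∣

IsLabelling : ∀ {t s} → ℕ → (ℕ → Set) → (Vert t s → ℕ) → Set
IsLabelling {t} {s} bound P f =
  Injective _≡_ _≡_ f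
  × (∀ v → f v ≤ bound)
  × Injective _≡_ _≡_ (edgeLabel f)
  × (∀ e → P (edgeLabel f e))
  × (∀ k → P k → Σ (Edge t s) λ e → edgeLabel f e ≡ k)

Range1 : ℕ → ℕ → Set
Range1 m k = 1 ≤ k × k ≤ m

Range1' : ℕ → ℕ → Set
Range1' m k = (1 ≤ k × k ≤ m ∸ 1) ⊎ k ≡ suc m

IsGraceful : ∀ {t s} → (Vert t s → ℕ) → Set
IsGraceful {t} {s} f = IsLabelling (edges t s) (Range1 (edges t s)) f

IsNearGraceful : ∀ {t s} → (Vert t s → ℕ) → Set
IsNearGraceful {t} {s} f =
  IsLabelling (suc (edges t s)) (Range1 (edges t s)) f
  ⊎ IsLabelling (suc (edges t s)) (Range1' (edges t s)) f

Graceful : ℕ → ℕ → Set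
Graceful t s = Σ (Vert t s → ℕ) IsGraceful

NearGraceful : ℕ → ℕ → Set
NearGraceful t s = Σ (Vert t s → ℕ) IsNearGraceful

{-# OPTIONS --safe #-}
module Submission where

-- Label the centre 0, so that every rim vertex has the label of the edge joining it to the centre.
-- A (hooked) Skolem sequence of order t, shifted past t + 4s, provides t triangles with edge labels
-- 1, …, t and t + 4s + 1, …, 3t + 4s (resp. the last one increased by 1).  It remains to cover
-- t + 1, …, t + 4s by s squares, each having two consecutive rim labels x and x - 1.  If s is at
-- most about t / 2, pair the two halves of this interval in reverse order: the square with rim
-- labels x, x - 1 and other labels x - y, x - 1 - y has the opposite vertex y, and the numbers y are
-- 2, 6, 10, …, all distinct and below the rim labels.  If s is larger, first cut off a number a of initial
-- blocks of four labels, where a square uses two labels of its block for the rim and has the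
-- opposite vertex 2t + 8j + 5; a is chosen so that the reversed pairing works for the rest, and
-- residues modulo 4 keep all vertices distinct.  Since there are as many edges as labels,
-- attaining all labels suffices for the injectivity of the edge labelling.

open import Defs
open import Data.Nat using (ℕ; zero; suc; _+_; _*_; _∸_; _≤_; _<_; z≤n; s≤s; s≤s⁻¹; _<?_; _≤?_; ∣_-_∣)
open import Data.Nat.DivMod using (_%_; [m+kn]%n≡m%n)
open import Data.Nat.Properties
open import Data.Nat.Tactic.RingSolver using (solve)
open import Data.Fin using (Fin; zero; suc; toℕ; fromℕ<; combine; join; splitAt; punchOut)
open import Data.Fin.Properties as Fin using (toℕ<n; toℕ-fromℕ<; toℕ-injective; injective⇒≤; punchOut-injective; combine-injective; splitAt-join; join-splitAt)
open import Data.List using (List; []; _∷_; _++_; length; lookup)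
open import Data.List.Properties using (length-++)
open import Data.List.Relation.Unary.Any using (Any; here; there; any?; index)
open import Data.List.Relation.Unary.Any.Properties using (++⁺ˡ; ++⁺ʳ; lookup-index)
open import Data.Product using (Σ; ∃; ∃₂; _×_; _,_; proj₁; proj₂)
open import Data.Sum using (_⊎_; inj₁; inj₂; [_,_]′)
open import Data.Sum.Properties using (inj₁-injective; inj₂-injective)
open import Function using (_∘_)
open import Function.Definitions using (Injective)
open import Relation.Nullary using (Dec; yes; no; contradiction)
open import Relation.Nullary.Decidable using (_⊎-dec_; from-yes)
open import Relation.Binary.PropositionalEquality using (_≡_; _≢_; refl; sym; trans; cong; subst)

-- Counting

-- Pigeonhole: a missed value could be punched out, leaving an injection of `Fin (suc n)` into
-- `Fin n`.
injective⇒surjective : ∀ {n} {f : Fin n → Fin n} → Injective _≡_ _≡_ f → ∀ j → ∃ λ i → f i ≡ j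
injective⇒surjective {suc n} {f} f-inj j with Fin.any? (λ i → f i Fin.≟ j)
... | yes hit = hit
... | no miss = contradiction (injective⇒≤ {f = λ i → punchOut (j≢f i)} punched-injective) 1+n≰n
  where
  j≢f : ∀ i → j ≢ f i
  j≢f i eq = miss (i , sym eq)
  punched-injective : Injective _≡_ _≡_ (λ i → punchOut (j≢f i))
  punched-injective {a} {b} = f-inj ∘ punchOut-injective (j≢f a) (j≢f b)

edgeSum : ∀ {t s} → Edge t s → Fin (3 * t) ⊎ Fin (4 * s)
edgeSum (triE i c) = inj₁ (combine c i)
edgeSum (sqE j c)  = inj₂ (combine c j)

edgeSum-injective : ∀ {t s} → Injective _≡_ _≡_ (edgeSum {t} {s})
edgeSum-injective {x = triE i c} {triE i′ c′} eq
  with refl , refl ← combine-injective c i c′ i′ (inj₁-injective eq) = refl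
edgeSum-injective {x = sqE j c} {sqE j′ c′} eq
  with refl , refl ← combine-injective c j c′ j′ (inj₂-injective eq) = refl

edgeIndex : ∀ {t s} → Edge t s → Fin (edges t s)
edgeIndex {t} {s} = join (3 * t) (4 * s) ∘ edgeSum

edgeIndex-injective : ∀ {t s} → Injective _≡_ _≡_ (edgeIndex {t} {s})
edgeIndex-injective {t} {s} {x} {y} eq = edgeSum-injective
  (trans (sym (splitAt-join (3 * t) (4 * s) (edgeSum x)))
    (trans (cong (splitAt (3 * t)) eq) (splitAt-join (3 * t) (4 * s) (edgeSum y))))

Enumerates : (n : ℕ) → (ℕ → Set) → Set
Enumerates n P = Σ (Fin n → ℕ) λ label → Injective _≡_ _≡_ label × (∀ i → P (label i))

enumerates-Range1 : ∀ n → Enumerates n (Range1 n)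
enumerates-Range1 n = suc ∘ toℕ , toℕ-injective ∘ suc-injective , λ i → s≤s z≤n , toℕ<n i

enumerates-Range1′ : ∀ n → Enumerates n (Range1' n)
enumerates-Range1′ zero    = (λ ()) , (λ { {()} }) , λ ()
enumerates-Range1′ (suc n) = label , label-injective , label-Range1'
  where
  label : Fin (suc n) → ℕ
  -- With `suc n` edges, the label `suc n` is skipped in favour of `suc (suc n)`.
  label zero    = suc (suc n)
  label (suc i) = suc (toℕ i)
  label≢ : ∀ (i : Fin n) → suc (toℕ i) ≢ suc (suc n)
  label≢ i eq = <-irrefl (suc-injective eq) (m<n⇒m<1+n (toℕ<n i))
  label-injective : Injective _≡_ _≡_ label
  label-injective {zero}  {zero}  eq = refl
  label-injective {zero}  {suc j} eq = contradiction (sym eq) (label≢ j)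
  label-injective {suc i} {zero}  eq = contradiction eq (label≢ i)
  label-injective {suc i} {suc j} eq = cong suc (toℕ-injective (suc-injective eq))
  label-Range1' : ∀ i → Range1' (suc n) (label i)
  label-Range1' zero    = inj₂ refl
  label-Range1' (suc i) = inj₁ (s≤s z≤n , toℕ<n i)

Attained : ∀ {t s} → (Vert t s → ℕ) → ℕ → Set
Attained {t} {s} f k = Σ (Edge t s) λ e → edgeLabel f e ≡ k

module _ {t s} {P : ℕ → Set} (f : Vert t s → ℕ)
         (enum : Enumerates (edges t s) P) (attain : ∀ k → P k → Attained f k) where

  private
    label = proj₁ enum
    label-injective = proj₁ (proj₂ enum)
    label-P = proj₂ (proj₂ enum)

    edge : Fin (edges t s) → Edge t s
    edge i = proj₁ (attain (label i) (label-P i))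

    edge-label : ∀ i → edgeLabel f (edge i) ≡ label i
    edge-label i = proj₂ (attain (label i) (label-P i))

    edge-injective : Injective _≡_ _≡_ edge
    edge-injective {i} {j} eq =
      label-injective (trans (sym (edge-label i)) (trans (cong (edgeLabel f) eq) (edge-label j)))

    edge-surjective : ∀ e → ∃ λ i → edge i ≡ e
    edge-surjective e =
      -- `edgeIndex ∘ edge` is an injective self-map of a finite set, hence reaches the index of
      -- `e`.
      let i , eq = injective⇒surjective (edge-injective ∘ edgeIndex-injective) (edgeIndex e)
      in i , edgeIndex-injective eq

  -- Every edge is the one chosen for some label, so its label determines it.
  attained⇒injective : Injective _≡_ _≡_ (edgeLabel f)
  attained⇒injective {e} {e′} eq
    with i , refl ← edge-surjective e | j , refl ← edge-surjective e′ =
    cong edge (label-injective (trans (sym (edge-label i)) (trans eq (edge-label j))))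

  attained⇒∈ : ∀ e → P (edgeLabel f e)
  attained⇒∈ e with i , refl ← edge-surjective e = subst P (sym (edge-label i)) (label-P i)

-- Labellings with centre 0

record Vanes (t s : ℕ) : Set where
  field
    p q   : Fin t → ℕ
    x y z : Fin s → ℕ

module _ {t s} (V : Vanes t s) where
  open Vanes V

  labelling : Vert t s → ℕ
  labelling centre                   = 0
  labelling (tri i zero)             = p i
  labelling (tri i (suc zero))       = q i
  labelling (sq j zero)              = x j
  labelling (sq j (suc zero))        = y j
  labelling (sq j (suc (suc zero)))  = z j

  -- Recovers a rim vertex from its edge to the centre; edges avoiding the centre get the dummy
  -- value `centre`.
  outer : Edge t s → Vert t s
  outer (triE i zero)                  = tri i zero
  outer (triE i (suc zero))            = centre
  outer (triE i (suc (suc zero)))      = tri i (suc zero)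
  outer (sqE j zero)                   = sq j zero
  outer (sqE j (suc zero))             = centre
  outer (sqE j (suc (suc zero)))       = centre
  outer (sqE j (suc (suc (suc zero)))) = sq j (suc (suc zero))

  record OppositesSeparated (bound : ℕ) : Set where
    field
      y-injective : Injective _≡_ _≡_ y
      y≥1         : ∀ j → 1 ≤ y j
      y≤bound     : ∀ j → y j ≤ bound
      y≢p         : ∀ j i → y j ≢ p i
      y≢q         : ∀ j i → y j ≢ q i
      y≢x         : ∀ j i → y j ≢ x i
      y≢z         : ∀ j i → y j ≢ z i

  module _ {bound} {P : ℕ → Set} (P⇒≥1 : ∀ {k} → P k → 1 ≤ k) (P⇒≤ : ∀ {k} → P k → k ≤ bound)
           (enum : Enumerates (edges t s) P) (attain : ∀ k → P k → Attained labelling k)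
           (sep : OppositesSeparated bound) where
    open OppositesSeparated sep

    private
      -- The edge from the centre to a rim vertex carries the label of that vertex, so the edge
      -- labels control all vertices except those opposite to the centre in a 4-cycle.
      data Position : Vert t s → Set where
        hub      : Position centre
        rim      : ∀ e {v} → outer e ≡ v → edgeLabel labelling e ≡ labelling v →
                   (∀ j → y j ≢ labelling v) → Position v
        opposite : ∀ j → Position (sq j (suc zero))

      position : ∀ v → Position v
      position centre                  = hub
      position (tri i zero)            = rim (triE i zero) refl refl (λ j → y≢p j i)
      position (tri i (suc zero))      = rim (triE i (suc (suc zero))) refl (∣-∣-identityʳ _) (λ j → y≢q j i)
      position (sq i zero)             = rim (sqE i zero) refl refl (λ j → y≢x j i)
      position (sq i (suc zero))       = opposite i
      position (sq i (suc (suc zero))) = rim (sqE i (suc (suc (suc zero)))) refl (∣-∣-identityʳ _) (λ j → y≢z j i)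

      rim∈P : ∀ e {k} → edgeLabel labelling e ≡ k → P k
      rim∈P e eq = subst P eq (attained⇒∈ labelling enum attain e)

      0∉P : ∀ {k} → P k → k ≢ 0
      0∉P Pk refl = contradiction (P⇒≥1 Pk) 1+n≰n

      y≢0 : ∀ j → y j ≢ 0
      y≢0 j eq = contradiction (subst (1 ≤_) eq (y≥1 j)) 1+n≰n

      injective : ∀ {u v} → Position u → Position v → labelling u ≡ labelling v → u ≡ v
      injective hub            hub            eq = refl
      injective hub            (rim e _ l _)  eq = contradiction (sym eq) (0∉P (rim∈P e l))
      injective hub            (opposite j)   eq = contradiction (sym eq) (y≢0 j)
      injective (rim e _ l _)  hub            eq = contradiction eq (0∉P (rim∈P e l))
      injective (rim e o l _)  (rim e′ o′ l′ _) eq =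
        trans (sym o) (trans (cong outer
          (attained⇒injective labelling enum attain (trans l (trans eq (sym l′))))) o′)
      injective (rim _ _ _ y≢) (opposite j)   eq = contradiction (sym eq) (y≢ j)
      injective (opposite j)   hub            eq = contradiction eq (y≢0 j)
      injective (opposite j)   (rim _ _ _ y≢) eq = contradiction eq (y≢ j)
      injective (opposite j)   (opposite j′)  eq = cong (λ i → sq i (suc zero)) (y-injective eq)

      bounded : ∀ {v} → Position v → labelling v ≤ bound
      bounded hub            = z≤n
      bounded (rim e _ l _)  = P⇒≤ (rim∈P e l)
      bounded (opposite j)   = y≤bound j

    isLabelling : IsLabelling bound P labelling
    isLabelling = injective (position _) (position _) , bounded ∘ position
      , attained⇒injective labelling enum attain , attained⇒∈ labelling enum attain , attain

-- Intervals

-- Half-open intervals, so that adjacent pieces share an endpoint and chain by `⟫`.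
record Covers (P : ℕ → Set) (a b : ℕ) : Set where
  constructor covers
  field covered : ∀ {k} → a ≤ k → k < b → P k
open Covers

infixr 5 _⟫_
_⟫_ : ∀ {P a b c} → Covers P a b → Covers P b c → Covers P a c
_⟫_ {P} {a} {b} {c} left right = covers either
  where
  either : ∀ {k} → a ≤ k → k < c → P k
  either {k} a≤k k<c with k <? b
  ... | yes k<b = covered left a≤k k<b
  ... | no  k≮b = covered right (≮⇒≥ k≮b) k<c

nowhere : ∀ {P} a → Covers P a a
nowhere a = covers λ a≤k k<a → contradiction k<a (≤⇒≯ a≤k)

-- The right end is free up to an equation, so a piece can end literally where the next begins and
-- the ring solver checks its length.
run : ∀ {P} a n b → b ≡ a + n → (∀ i → i < n → P (a + i)) → Covers P a b
run {P} a n _ refl f = covers λ {k} a≤k k<b →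
  subst P (m+[n∸m]≡n a≤k) (f (k ∸ a) (+-cancelˡ-< a _ _ (subst (_< a + n) (sym (m+[n∸m]≡n a≤k)) k<b)))

at : ∀ {P} a → P a → Covers P a (suc a)
at {P} a Pa = covers λ a≤k k<1+a → subst P (≤-antisym a≤k (s≤s⁻¹ k<1+a)) Pa

below : ∀ {P} c b → c ≡ b → Covers P 0 b → ∀ k → k < c → P k
below _ _ refl cov k = covered cov z≤n

below-pred : ∀ {P} c b → c ≡ suc b → Covers P 0 b → ∀ k → suc k < c → P k
below-pred _ _ refl cov k = covered cov z≤n ∘ s≤s⁻¹

-- Skolem sequences

-- A pair (a , d) stands for the two places a and a + d, at distance d; places are numbered from 0.
Pairs : Set
Pairs = List (ℕ × ℕ)

AtDistance : ℕ → ℕ × ℕ → Set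
AtDistance k (a , d) = d ≡ k

AtPlace : ℕ → ℕ × ℕ → Set
AtPlace k (a , d) = a ≡ k ⊎ a + d ≡ k

HasDistance : Pairs → ℕ → Set
HasDistance ts k = Any (AtDistance k) ts

HasPlace : Pairs → ℕ → Set
HasPlace ts k = Any (AtPlace k) ts

-- In both uses `U` has 2n elements for n ≥ 1, so with `n` pairs, occurring means occurring exactly
-- once.
SkolemOn : (ℕ → Set) → ℕ → Set
SkolemOn U n = Σ Pairs λ ts →
  length ts ≡ n × (∀ k → k < n → HasDistance ts (suc k)) × (∀ k → U k → HasPlace ts k)

Skolem : ℕ → Set
Skolem n = SkolemOn (λ k → k < 2 * n) n

-- The place 2n - 1 stays empty: this is the hook.
HookedSkolem : ℕ → Set
HookedSkolem n = SkolemOn (λ k → suc k < 2 * n ⊎ k ≡ 2 * n) n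

-- Nested pairs with distances e, e + 2, …, e + 2(n - 1), the outermost one starting at a.
nest : ℕ → ℕ → ℕ → Pairs
nest a e zero    = []
nest a e (suc n) = (a , e + 2 * n) ∷ nest (suc a) e n

length-nest : ∀ a e n → length (nest a e n) ≡ n
length-nest a e zero    = refl
length-nest a e (suc n) = cong suc (length-nest (suc a) e n)

-- In the uses `r` is 1 or 2 and fixes the parity; `b` is the index of the innermost distance among
-- those of that parity.
nest-distance : ∀ a e n r b → e ≡ r + 2 * b → ∀ i → i < n → HasDistance (nest a e n) (r + 2 * (b + i))
nest-distance a e (suc n) r b refl i i<1+n with m≤n⇒m<n∨m≡n (s≤s⁻¹ i<1+n)
... | inj₁ i<n  = there (nest-distance (suc a) e n r b refl i i<n)
... | inj₂ refl = here (solve (r ∷ b ∷ n ∷ []))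

nest-start : ∀ a e n i → i < n → HasPlace (nest a e n) (a + i)
nest-start a e (suc n) zero    _         = here (inj₁ (sym (+-identityʳ a)))
nest-start a e (suc n) (suc i) (s≤s i<n) =
  there (subst (HasPlace _) (sym (+-suc a i)) (nest-start (suc a) e n i i<n))

-- Starting one place later and shortening by two moves the end one place back, so the ends also
-- fill an interval. Its least element `b` is the end of the innermost pair; the distance `suc e`
-- absorbs the subtraction in a + (n - 1).
nest-end : ∀ a e n b → b ≡ a + n + e → ∀ i → i < n → HasPlace (nest a (suc e) n) (b + i)
nest-end a e (suc n) _ refl i i<1+n with m≤n⇒m<n∨m≡n (s≤s⁻¹ i<1+n)
... | inj₁ i<n  = there (nest-end (suc a) e n (a + suc n + e) (cong (_+ e) (+-suc a n)) i i<n)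
... | inj₂ refl = here (inj₂ (solve (a ∷ e ∷ n ∷ [])))

data Parity : ℕ → Set where
  even : ∀ i → Parity (2 * i)
  odd  : ∀ i → Parity (suc (2 * i))

parity : ∀ k → Parity k
parity zero = even 0
parity (suc k) with parity k
... | even i = odd i
... | odd i  = subst Parity (*-suc 2 i) (even (suc i))

-- Each nested family has distances of a single parity, so odd and even ones are covered separately;
-- `a` and `b` count them.
distances : ∀ ts n a b → n ≤ 2 * a → n ≤ suc (2 * b) →
            Covers (λ i → HasDistance ts (1 + 2 * i)) 0 a →
            Covers (λ i → HasDistance ts (2 + 2 * i)) 0 b →
            ∀ k → k < n → HasDistance ts (suc k)
distances ts n a b n≤2a n≤2b+1 odds evens k k<n with parity k
... | even i = covered odds z≤n (*-cancelˡ-< 2 i a (<-≤-trans k<n n≤2a))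
... | odd i  = covered evens z≤n (*-cancelˡ-< 2 i b (s≤s⁻¹ (<-≤-trans k<n n≤2b+1)))

length-nests : ∀ a e n a′ e′ n′ a″ e″ n″ →
               length (nest a e n ++ nest a′ e′ n′ ++ nest a″ e″ n″) ≡ n + (n′ + n″)
length-nests a e n a′ e′ n′ a″ e″ n″
  rewrite length-++ (nest a e n) {nest a′ e′ n′ ++ nest a″ e″ n″} | length-++ (nest a′ e′ n′) {nest a″ e″ n″}
        | length-nest a e n | length-nest a′ e′ n′ | length-nest a″ e″ n″ = refl

module Assembly (specials F₁ F₂ F₃ : Pairs) where
  pairs : Pairs
  pairs = specials ++ F₁ ++ F₂ ++ F₃

  module _ {Q : ℕ × ℕ → Set} where
    first : Any Q F₁ → Any Q pairs
    first = ++⁺ʳ specials ∘ ++⁺ˡ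

    second : Any Q F₂ → Any Q pairs
    second = ++⁺ʳ specials ∘ ++⁺ʳ F₁ ∘ ++⁺ˡ

    third : Any Q F₃ → Any Q pairs
    third = ++⁺ʳ specials ∘ ++⁺ʳ F₁ ∘ ++⁺ʳ F₂

-- The nested families and exceptional pairs are those of Skolem for n ≡ 0, 1 (mod 4) and of
-- O'Keefe for n ≡ 2, 3 (mod 4), with places renumbered from 0.
skolem₀ : ∀ k → Skolem (4 * (2 + k))
skolem₀ k = pairs
  , trans (cong (4 +_) (length-nests (7 + 4 * k) 2 (4 + 2 * k) 0 (7 + 2 * k) k (3 + k) 3 k)) (solve (k ∷ []))
  , distances pairs (4 * (2 + k)) (4 + 2 * k) (4 + 2 * k)
      (≤-reflexive (solve (k ∷ []))) (m≤n⇒m≤1+n (≤-reflexive (solve (k ∷ [])))) odds evens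
  , below (2 * (4 * (2 + k))) (16 + 8 * k) (solve (k ∷ [])) places
  where
  -- Order 8 + 4k. The first nest takes all even distances and fills the right part, except for a
  -- gap at 11 + 6k where the pair of distance 7 + 4k arrives from the left part. There the third
  -- nest lies inside the second, and the other exceptional pairs fill the remaining places.
  open Assembly ((k , 5 + 2 * k) ∷ (1 + k , 1) ∷ (3 + 2 * k , 3 + 2 * k) ∷ (4 + 2 * k , 7 + 4 * k) ∷ [])
    (nest (7 + 4 * k) 2 (4 + 2 * k)) (nest 0 (7 + 2 * k) k) (nest (3 + k) 3 k)
  odds : Covers (λ j → HasDistance pairs (1 + 2 * j)) 0 (4 + 2 * k)
  odds =
    at 0 (there (here (solve (k ∷ []))))
    ⟫ run 1 k (1 + k) (solve (k ∷ [])) (λ j → third ∘ nest-distance (3 + k) 3 k 1 1 (solve (k ∷ [])) j)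
    ⟫ at (1 + k) (there (there (here (solve (k ∷ [])))))
    ⟫ at (2 + k) (here (solve (k ∷ [])))
    ⟫ run (3 + k) k (3 + 2 * k) (solve (k ∷ []))
        (λ j → second ∘ nest-distance 0 (7 + 2 * k) k 1 (3 + k) (solve (k ∷ [])) j)
    ⟫ at (3 + 2 * k) (there (there (there (here (solve (k ∷ []))))))
  evens : Covers (λ j → HasDistance pairs (2 + 2 * j)) 0 (4 + 2 * k)
  evens =
    run 0 (4 + 2 * k) (4 + 2 * k) (solve (k ∷ []))
        (λ j → first ∘ nest-distance (7 + 4 * k) 2 (4 + 2 * k) 2 0 (solve (k ∷ [])) j)
  places : Covers (HasPlace pairs) 0 (16 + 8 * k)
  places =
    run 0 k k (solve (k ∷ [])) (λ j → second ∘ nest-start 0 (7 + 2 * k) k j)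
    ⟫ at k (here (inj₁ refl))
    ⟫ at (1 + k) (there (here (inj₁ refl)))
    ⟫ at (2 + k) (there (here (inj₂ (solve (k ∷ [])))))
    ⟫ run (3 + k) k (3 + 2 * k) (solve (k ∷ [])) (λ j → third ∘ nest-start (3 + k) 3 k j)
    ⟫ at (3 + 2 * k) (there (there (here (inj₁ refl))))
    ⟫ at (4 + 2 * k) (there (there (there (here (inj₁ refl)))))
    ⟫ run (5 + 2 * k) k (5 + 3 * k) (solve (k ∷ []))
        (λ j → third ∘ nest-end (3 + k) 2 k (5 + 2 * k) (solve (k ∷ [])) j)
    ⟫ at (5 + 3 * k) (here (inj₂ (solve (k ∷ []))))
    ⟫ run (6 + 3 * k) k (6 + 4 * k) (solve (k ∷ []))
        (λ j → second ∘ nest-end 0 (6 + 2 * k) k (6 + 3 * k) (solve (k ∷ [])) j)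
    ⟫ at (6 + 4 * k) (there (there (here (inj₂ (solve (k ∷ []))))))
    ⟫ run (7 + 4 * k) (4 + 2 * k) (11 + 6 * k) (solve (k ∷ []))
        (λ j → first ∘ nest-start (7 + 4 * k) 2 (4 + 2 * k) j)
    ⟫ at (11 + 6 * k) (there (there (there (here (inj₂ (solve (k ∷ [])))))))
    ⟫ run (12 + 6 * k) (4 + 2 * k) (16 + 8 * k) (solve (k ∷ []))
        (λ j → first ∘ nest-end (7 + 4 * k) 1 (4 + 2 * k) (12 + 6 * k) (solve (k ∷ [])) j)

skolem₁ : ∀ k → Skolem (4 * (2 + k) + 1)
skolem₁ k = pairs
  , trans (cong (3 +_) (length-nests (9 + 4 * k) 2 (4 + 2 * k) 0 (5 + 2 * k) (2 + k) (4 + k) 3 k)) (solve (k ∷ []))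
  , distances pairs (4 * (2 + k) + 1) (5 + 2 * k) (4 + 2 * k)
      (≤-trans (n≤1+n _) (≤-reflexive (solve (k ∷ [])))) (≤-reflexive (solve (k ∷ []))) odds evens
  , below (2 * (4 * (2 + k) + 1)) (18 + 8 * k) (solve (k ∷ [])) places
  where
  -- The same design for order 9 + 4k; the pair joining the two parts now has the largest distance.
  open Assembly ((2 + k , 1) ∷ (4 + 2 * k , 9 + 4 * k) ∷ (5 + 2 * k , 3 + 2 * k) ∷ [])
    (nest (9 + 4 * k) 2 (4 + 2 * k)) (nest 0 (5 + 2 * k) (2 + k)) (nest (4 + k) 3 k)
  odds : Covers (λ j → HasDistance pairs (1 + 2 * j)) 0 (5 + 2 * k)
  odds =
    at 0 (here (solve (k ∷ [])))
    ⟫ run 1 k (1 + k) (solve (k ∷ [])) (λ j → third ∘ nest-distance (4 + k) 3 k 1 1 (solve (k ∷ [])) j)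
    ⟫ at (1 + k) (there (there (here (solve (k ∷ [])))))
    ⟫ run (2 + k) (2 + k) (4 + 2 * k) (solve (k ∷ []))
        (λ j → second ∘ nest-distance 0 (5 + 2 * k) (2 + k) 1 (2 + k) (solve (k ∷ [])) j)
    ⟫ at (4 + 2 * k) (there (here (solve (k ∷ []))))
  evens : Covers (λ j → HasDistance pairs (2 + 2 * j)) 0 (4 + 2 * k)
  evens =
    run 0 (4 + 2 * k) (4 + 2 * k) (solve (k ∷ []))
        (λ j → first ∘ nest-distance (9 + 4 * k) 2 (4 + 2 * k) 2 0 (solve (k ∷ [])) j)
  places : Covers (HasPlace pairs) 0 (18 + 8 * k)
  places =
    run 0 (2 + k) (2 + k) (solve (k ∷ [])) (λ j → second ∘ nest-start 0 (5 + 2 * k) (2 + k) j)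
    ⟫ at (2 + k) (here (inj₁ refl))
    ⟫ at (3 + k) (here (inj₂ (solve (k ∷ []))))
    ⟫ run (4 + k) k (4 + 2 * k) (solve (k ∷ [])) (λ j → third ∘ nest-start (4 + k) 3 k j)
    ⟫ at (4 + 2 * k) (there (here (inj₁ refl)))
    ⟫ at (5 + 2 * k) (there (there (here (inj₁ refl))))
    ⟫ run (6 + 2 * k) k (6 + 3 * k) (solve (k ∷ []))
        (λ j → third ∘ nest-end (4 + k) 2 k (6 + 2 * k) (solve (k ∷ [])) j)
    ⟫ run (6 + 3 * k) (2 + k) (8 + 4 * k) (solve (k ∷ []))
        (λ j → second ∘ nest-end 0 (4 + 2 * k) (2 + k) (6 + 3 * k) (solve (k ∷ [])) j)
    ⟫ at (8 + 4 * k) (there (there (here (inj₂ (solve (k ∷ []))))))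
    ⟫ run (9 + 4 * k) (4 + 2 * k) (13 + 6 * k) (solve (k ∷ []))
        (λ j → first ∘ nest-start (9 + 4 * k) 2 (4 + 2 * k) j)
    ⟫ at (13 + 6 * k) (there (here (inj₂ (solve (k ∷ [])))))
    ⟫ run (14 + 6 * k) (4 + 2 * k) (18 + 8 * k) (solve (k ∷ []))
        (λ j → first ∘ nest-end (9 + 4 * k) 1 (4 + 2 * k) (14 + 6 * k) (solve (k ∷ [])) j)

hooked₂ : ∀ k → HookedSkolem (4 * (1 + k) + 2)
hooked₂ k = pairs
  , trans (cong (4 +_) (length-nests 0 2 (2 + 2 * k) (7 + 4 * k) (5 + 2 * k) k (7 + 5 * k) 3 k)) (solve (k ∷ []))
  , distances pairs (4 * (1 + k) + 2) (3 + 2 * k) (3 + 2 * k)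
      (≤-reflexive (solve (k ∷ []))) (m≤n⇒m≤1+n (≤-reflexive (solve (k ∷ [])))) odds evens
  , placed
  where
  -- Order n = 6 + 4k. The even nest is now on the left, and the pair of distance n runs from place
  -- n to place 2n, beyond the hook.
  open Assembly ((2 + 2 * k , 5 + 4 * k) ∷ (5 + 4 * k , 3 + 2 * k) ∷ (6 + 4 * k , 6 + 4 * k) ∷ (9 + 7 * k , 1) ∷ [])
    (nest 0 2 (2 + 2 * k)) (nest (7 + 4 * k) (5 + 2 * k) k) (nest (7 + 5 * k) 3 k)
  odds : Covers (λ j → HasDistance pairs (1 + 2 * j)) 0 (3 + 2 * k)
  odds =
    at 0 (there (there (there (here (solve (k ∷ []))))))
    ⟫ run 1 k (1 + k) (solve (k ∷ [])) (λ j → third ∘ nest-distance (7 + 5 * k) 3 k 1 1 (solve (k ∷ [])) j)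
    ⟫ at (1 + k) (there (here (solve (k ∷ []))))
    ⟫ run (2 + k) k (2 + 2 * k) (solve (k ∷ []))
        (λ j → second ∘ nest-distance (7 + 4 * k) (5 + 2 * k) k 1 (2 + k) (solve (k ∷ [])) j)
    ⟫ at (2 + 2 * k) (here (solve (k ∷ [])))
  evens : Covers (λ j → HasDistance pairs (2 + 2 * j)) 0 (3 + 2 * k)
  evens =
    run 0 (2 + 2 * k) (2 + 2 * k) (solve (k ∷ []))
        (λ j → first ∘ nest-distance 0 2 (2 + 2 * k) 2 0 (solve (k ∷ [])) j)
    ⟫ at (2 + 2 * k) (there (there (here (solve (k ∷ [])))))
  places : Covers (HasPlace pairs) 0 (11 + 8 * k)
  places =
    run 0 (2 + 2 * k) (2 + 2 * k) (solve (k ∷ [])) (λ j → first ∘ nest-start 0 2 (2 + 2 * k) j)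
    ⟫ at (2 + 2 * k) (here (inj₁ refl))
    ⟫ run (3 + 2 * k) (2 + 2 * k) (5 + 4 * k) (solve (k ∷ []))
        (λ j → first ∘ nest-end 0 1 (2 + 2 * k) (3 + 2 * k) (solve (k ∷ [])) j)
    ⟫ at (5 + 4 * k) (there (here (inj₁ refl)))
    ⟫ at (6 + 4 * k) (there (there (here (inj₁ refl))))
    ⟫ run (7 + 4 * k) k (7 + 5 * k) (solve (k ∷ [])) (λ j → second ∘ nest-start (7 + 4 * k) (5 + 2 * k) k j)
    ⟫ run (7 + 5 * k) k (7 + 6 * k) (solve (k ∷ [])) (λ j → third ∘ nest-start (7 + 5 * k) 3 k j)
    ⟫ at (7 + 6 * k) (here (inj₂ (solve (k ∷ []))))
    ⟫ at (8 + 6 * k) (there (here (inj₂ (solve (k ∷ [])))))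
    ⟫ run (9 + 6 * k) k (9 + 7 * k) (solve (k ∷ []))
        (λ j → third ∘ nest-end (7 + 5 * k) 2 k (9 + 6 * k) (solve (k ∷ [])) j)
    ⟫ at (9 + 7 * k) (there (there (there (here (inj₁ refl)))))
    ⟫ at (10 + 7 * k) (there (there (there (here (inj₂ (solve (k ∷ [])))))))
    ⟫ run (11 + 7 * k) k (11 + 8 * k) (solve (k ∷ []))
        (λ j → second ∘ nest-end (7 + 4 * k) (4 + 2 * k) k (11 + 7 * k) (solve (k ∷ [])) j)
  placed : ∀ j → suc j < 2 * (4 * (1 + k) + 2) ⊎ j ≡ 2 * (4 * (1 + k) + 2) → HasPlace pairs j
  placed j (inj₁ j+1<2n) = below-pred (2 * (4 * (1 + k) + 2)) (11 + 8 * k) (solve (k ∷ [])) places j j+1<2n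
  placed j (inj₂ refl)   = (there (there (here (inj₂ (solve (k ∷ []))))))

hooked₃ : ∀ k → HookedSkolem (4 * (1 + k) + 3)
hooked₃ k = pairs
  , trans (cong (5 +_) (length-nests (8 + 4 * k) 2 (2 + 2 * k) 0 (7 + 2 * k) k (3 + k) 3 k)) (solve (k ∷ []))
  , distances pairs (4 * (1 + k) + 3) (4 + 2 * k) (3 + 2 * k)
      (≤-trans (n≤1+n _) (≤-reflexive (solve (k ∷ [])))) (≤-reflexive (solve (k ∷ []))) odds evens
  , placed
  where
  -- Order n = 7 + 4k. The first three exceptional pairs and the last two nests are as in `skolem₀`;
  -- again the pair of distance n ends at 2n.
  open Assembly ((k , 5 + 2 * k) ∷ (1 + k , 1) ∷ (3 + 2 * k , 3 + 2 * k) ∷ (4 + 2 * k , 6 + 4 * k) ∷ (7 + 4 * k , 7 + 4 * k) ∷ [])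
    (nest (8 + 4 * k) 2 (2 + 2 * k)) (nest 0 (7 + 2 * k) k) (nest (3 + k) 3 k)
  odds : Covers (λ j → HasDistance pairs (1 + 2 * j)) 0 (4 + 2 * k)
  odds =
    at 0 (there (here (solve (k ∷ []))))
    ⟫ run 1 k (1 + k) (solve (k ∷ [])) (λ j → third ∘ nest-distance (3 + k) 3 k 1 1 (solve (k ∷ [])) j)
    ⟫ at (1 + k) (there (there (here (solve (k ∷ [])))))
    ⟫ at (2 + k) (here (solve (k ∷ [])))
    ⟫ run (3 + k) k (3 + 2 * k) (solve (k ∷ []))
        (λ j → second ∘ nest-distance 0 (7 + 2 * k) k 1 (3 + k) (solve (k ∷ [])) j)
    ⟫ at (3 + 2 * k) (there (there (there (there (here (solve (k ∷ [])))))))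
  evens : Covers (λ j → HasDistance pairs (2 + 2 * j)) 0 (3 + 2 * k)
  evens =
    run 0 (2 + 2 * k) (2 + 2 * k) (solve (k ∷ []))
        (λ j → first ∘ nest-distance (8 + 4 * k) 2 (2 + 2 * k) 2 0 (solve (k ∷ [])) j)
    ⟫ at (2 + 2 * k) (there (there (there (here (solve (k ∷ []))))))
  places : Covers (HasPlace pairs) 0 (13 + 8 * k)
  places =
    run 0 k k (solve (k ∷ [])) (λ j → second ∘ nest-start 0 (7 + 2 * k) k j)
    ⟫ at k (here (inj₁ refl))
    ⟫ at (1 + k) (there (here (inj₁ refl)))
    ⟫ at (2 + k) (there (here (inj₂ (solve (k ∷ [])))))
    ⟫ run (3 + k) k (3 + 2 * k) (solve (k ∷ [])) (λ j → third ∘ nest-start (3 + k) 3 k j)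
    ⟫ at (3 + 2 * k) (there (there (here (inj₁ refl))))
    ⟫ at (4 + 2 * k) (there (there (there (here (inj₁ refl)))))
    ⟫ run (5 + 2 * k) k (5 + 3 * k) (solve (k ∷ []))
        (λ j → third ∘ nest-end (3 + k) 2 k (5 + 2 * k) (solve (k ∷ [])) j)
    ⟫ at (5 + 3 * k) (here (inj₂ (solve (k ∷ []))))
    ⟫ run (6 + 3 * k) k (6 + 4 * k) (solve (k ∷ []))
        (λ j → second ∘ nest-end 0 (6 + 2 * k) k (6 + 3 * k) (solve (k ∷ [])) j)
    ⟫ at (6 + 4 * k) (there (there (here (inj₂ (solve (k ∷ []))))))
    ⟫ at (7 + 4 * k) (there (there (there (there (here (inj₁ refl))))))
    ⟫ run (8 + 4 * k) (2 + 2 * k) (10 + 6 * k) (solve (k ∷ []))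
        (λ j → first ∘ nest-start (8 + 4 * k) 2 (2 + 2 * k) j)
    ⟫ at (10 + 6 * k) (there (there (there (here (inj₂ (solve (k ∷ [])))))))
    ⟫ run (11 + 6 * k) (2 + 2 * k) (13 + 8 * k) (solve (k ∷ []))
        (λ j → first ∘ nest-end (8 + 4 * k) 1 (2 + 2 * k) (11 + 6 * k) (solve (k ∷ [])) j)
  placed : ∀ j → suc j < 2 * (4 * (1 + k) + 3) ⊎ j ≡ 2 * (4 * (1 + k) + 3) → HasPlace pairs j
  placed j (inj₁ j+1<2n) = below-pred (2 * (4 * (1 + k) + 3)) (13 + 8 * k) (solve (k ∷ [])) places j j+1<2n
  placed j (inj₂ refl)   = (there (there (there (there (here (inj₂ (solve (k ∷ []))))))))

-- Small orders and the four residue classes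

distance? : ∀ ts k → Dec (HasDistance ts (suc k))
distance? ts k = any? (λ (a , d) → d ≟ suc k) ts

place? : ∀ ts k → Dec (HasPlace ts k)
place? ts k = any? (λ (a , d) → (a ≟ k) ⊎-dec (a + d ≟ k)) ts

-- Here and in the next three, orders below the range of the general pattern are checked by
-- evaluation.
skolem-4w : ∀ w → Skolem (4 * w + 0)
skolem-4w 0 = [] , refl , (λ _ ()) , (λ _ ())
skolem-4w 1 = ts , refl 
  , (λ _ → from-yes (allUpTo? (distance? ts) 4)) , (λ _ → from-yes (allUpTo? (place? ts) 8))
  where
  ts : Pairs
  ts = (0 , 1) ∷ (3 , 2) ∷ (4 , 3) ∷ (2 , 4) ∷ []
skolem-4w (suc (suc k)) = subst Skolem (sym (+-identityʳ _)) (skolem₀ k)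

skolem-4w+1 : ∀ w → Skolem (4 * w + 1)
skolem-4w+1 0 = ts , refl 
  , (λ _ → from-yes (allUpTo? (distance? ts) 1)) , (λ _ → from-yes (allUpTo? (place? ts) 2))
  where
  ts : Pairs
  ts = (0 , 1) ∷ []
skolem-4w+1 1 = ts , refl 
  , (λ _ → from-yes (allUpTo? (distance? ts) 5)) , (λ _ → from-yes (allUpTo? (place? ts) 10))
  where
  ts : Pairs
  ts = (0 , 3) ∷ (1 , 5) ∷ (2 , 2) ∷ (5 , 4) ∷ (7 , 1) ∷ []
skolem-4w+1 (suc (suc k)) = skolem₁ k

hookedSkolem-4w+2 : ∀ w → HookedSkolem (4 * w + 2)
hookedSkolem-4w+2 0 = ts , refl , (λ _ → from-yes (allUpTo? (distance? ts) 2)) , λ where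
    k (inj₁ k+1<4) → from-yes (allUpTo? (place? ts) 3) (s≤s⁻¹ k+1<4)
    k (inj₂ refl)  → from-yes (place? ts 4)
  where
  ts : Pairs
  ts = (0 , 1) ∷ (2 , 2) ∷ []
hookedSkolem-4w+2 (suc k) = hooked₂ k

hookedSkolem-4w+3 : ∀ w → HookedSkolem (4 * w + 3)
hookedSkolem-4w+3 0 = ts , refl , (λ _ → from-yes (allUpTo? (distance? ts) 3)) , λ where
    k (inj₁ k+1<6) → from-yes (allUpTo? (place? ts) 5) (s≤s⁻¹ k+1<6)
    k (inj₂ refl)  → from-yes (place? ts 6)
  where
  ts : Pairs
  ts = (1 , 1) ∷ (4 , 2) ∷ (0 , 3) ∷ []
hookedSkolem-4w+3 (suc k) = hooked₃ k

-- 4-cycles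

blocks : ∀ {P} w c n → (∀ j → j < n → Covers P (c + j * w) (c + suc j * w)) → Covers P c (c + n * w)
blocks {P} w c zero    f = subst (Covers P c) (sym (+-identityʳ c)) (nowhere c)
blocks {P} w c (suc n) f = blocks w c n (λ j j<n → f j (m<n⇒m<1+n j<n)) ⟫ f n ≤-refl

∣m-n∣≡d : ∀ m n d → m ≡ n + d → ∣ m - n ∣ ≡ d
∣m-n∣≡d _ n d refl = trans (∣-∣-comm (n + d) n) (∣m-m+n∣≡n n d)

∣n-m∣≡d : ∀ m n d → m ≡ n + d → ∣ n - m ∣ ≡ d
∣n-m∣≡d _ n d refl = ∣m-m+n∣≡n n d

-- A square (x , y , z) has rim labels x and z, and y opposite to the centre.
Square : Set
Square = ℕ × ℕ × ℕ

xOf yOf zOf : Square → ℕ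
xOf (x , y , z) = x
yOf (x , y , z) = y
zOf (x , y , z) = z

HasLabel : Square → ℕ → Set
HasLabel (x , y , z) k = x ≡ k ⊎ ∣ x - y ∣ ≡ k ⊎ ∣ y - z ∣ ≡ k ⊎ z ≡ k

pattern x-label e  = inj₁ e
pattern xy-label e = inj₂ (inj₁ e)
pattern yz-label e = inj₂ (inj₂ (inj₁ e))
pattern z-label e  = inj₂ (inj₂ (inj₂ e))

-- In the squares `high` below, the labels t + 4j + 1, …, t + 4j + 4 are split into two consecutive
-- rim labels and two consecutive remaining ones.  Taking the upper or the lower two for the rim
-- (δ = 2 or δ = 0) according to t mod 4 keeps the rim and the opposite vertices apart modulo 4.
record Offset (t : ℕ) : Set where
  field
    δ     : ℕ
    δ-0-2 : δ ≡ 0 ⊎ δ ≡ 2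
    x≢2   : (2 + δ + t) % 4 ≢ 2
    z≢2   : (1 + δ + t) % 4 ≢ 2
    y≢2   : (5 + 2 * t) % 4 ≢ 2
    y≢x   : (5 + 2 * t) % 4 ≢ (2 + δ + t) % 4
    y≢z   : (5 + 2 * t) % 4 ≢ (1 + δ + t) % 4

%4-≢ : ∀ m n j k → m % 4 ≢ n % 4 → m + j * 4 ≢ n + k * 4
%4-≢ m n j k m≢n eq = m≢n (trans (sym ([m+kn]%n≡m%n m j 4)) (trans (cong (_% 4) eq) ([m+kn]%n≡m%n n k 4)))

-- `b-small` keeps the opposite vertices of `low` at or below `middle`, `a-small` those of `high`.
-- The guard `0 < a` admits few squares beside many triangles.
module Squares (t : ℕ) (offset : Offset t) (a b : ℕ)
               (b-small : 2 * b ≤ 2 + (t + 4 * a))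
               (a-small : 0 < a → t + 4 * a ≤ 3 + 2 * b) where
  open Offset offset

  middle : ℕ
  middle = t + 4 * a + 2 * b

  -- The opposite vertex is the sum of a rim label and another label in `high`, and the
  -- difference of two such labels in `low`.
  high low : ℕ → Square
  high j = 2 + δ + t + j * 4 , 5 + 2 * t + 2 * j * 4 , 1 + δ + t + j * 4
  low  j = 2 + middle + j * 2 , 2 + j * 4 , 1 + middle + j * 2

  square : Fin a ⊎ Fin b → Square
  square = [ high ∘ toℕ , low ∘ toℕ ]′

  SquareLabel : ℕ → Set
  SquareLabel k = ∃ λ u → HasLabel (square u) k

  high-label : ∀ {k} j → j < a → HasLabel (high j) k → SquareLabel k
  high-label {k} j j<a l = inj₁ (fromℕ< j<a) , subst (λ i → HasLabel (high i) k) (sym (toℕ-fromℕ< j<a)) l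

  low-label : ∀ {k} j → j < b → HasLabel (low j) k → SquareLabel k
  low-label {k} j j<b l = inj₂ (fromℕ< j<b) , subst (λ i → HasLabel (low i) k) (sym (toℕ-fromℕ< j<b)) l

  -- 5 + 2t + 8j is the sum of the two outer as well as of the two inner labels of the block, so
  -- subtracting either rim label leaves a non-rim one.
  high-block : ∀ j → j < a → Covers SquareLabel (suc t + j * 4) (suc t + suc j * 4)
  high-block j j<a = subst (Covers SquareLabel (suc t + j * 4)) end (four δ-0-2)
    where
    end : 5 + t + j * 4 ≡ suc t + suc j * 4
    end = solve (t ∷ j ∷ [])
    four : δ ≡ 0 ⊎ δ ≡ 2 → Covers SquareLabel (1 + t + j * 4) (5 + t + j * 4)
    four (inj₁ refl) =
      at (1 + t + j * 4) (high-label j j<a (z-label refl))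
      ⟫ at (2 + t + j * 4) (high-label j j<a (x-label refl))
      ⟫ at (3 + t + j * 4) (high-label j j<a (xy-label
          (∣n-m∣≡d (5 + 2 * t + 2 * j * 4) (2 + t + j * 4) (3 + t + j * 4) (solve (t ∷ j ∷ [])))))
      ⟫ at (4 + t + j * 4) (high-label j j<a (yz-label
          (∣m-n∣≡d (5 + 2 * t + 2 * j * 4) (1 + t + j * 4) (4 + t + j * 4) (solve (t ∷ j ∷ [])))))
    four (inj₂ refl) =
      at (1 + t + j * 4) (high-label j j<a (xy-label
          (∣n-m∣≡d (5 + 2 * t + 2 * j * 4) (4 + t + j * 4) (1 + t + j * 4) (solve (t ∷ j ∷ [])))))
      ⟫ at (2 + t + j * 4) (high-label j j<a (yz-label
          (∣m-n∣≡d (5 + 2 * t + 2 * j * 4) (3 + t + j * 4) (2 + t + j * 4) (solve (t ∷ j ∷ [])))))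
      ⟫ at (3 + t + j * 4) (high-label j j<a (z-label refl))
      ⟫ at (4 + t + j * 4) (high-label j j<a (x-label refl))

  low-rim-block : ∀ j → j < b → Covers SquareLabel (suc middle + j * 2) (suc middle + suc j * 2)
  low-rim-block j j<b = subst (Covers SquareLabel (suc middle + j * 2)) (end middle)
    (at (1 + middle + j * 2) (low-label j j<b (z-label refl))
     ⟫ at (2 + middle + j * 2) (low-label j j<b (x-label refl)))
    where
    end : ∀ m → 3 + m + j * 2 ≡ suc m + suc j * 2
    end m = solve (m ∷ j ∷ [])

  low-inner-block : ∀ r → r < b → Covers SquareLabel (suc (t + 4 * a) + r * 2) (suc (t + 4 * a) + suc r * 2)
  low-inner-block r r<b = subst (Covers SquareLabel (suc (t + 4 * a) + r * 2)) (end (t + 4 * a))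
    (at (1 + (t + 4 * a) + r * 2) (low-label j j<b (yz-label
       (∣n-m∣≡d (1 + middle + j * 2) (2 + j * 4) (1 + (t + 4 * a) + r * 2) (z-split (t + 4 * a) b b≡r+1+j))))
     ⟫ at (2 + (t + 4 * a) + r * 2) (low-label j j<b (xy-label
       (∣m-n∣≡d (2 + middle + j * 2) (2 + j * 4) (2 + (t + 4 * a) + r * 2) (x-split (t + 4 * a) b b≡r+1+j)))))
    where
    j : ℕ
    -- The reversal: as `j` grows by one, the rim labels grow by 2 and the opposite vertex by 4, so
    -- the differences drop by 2.
    j = b ∸ suc r
    b≡r+1+j : b ≡ suc r + j
    b≡r+1+j = sym (m+[n∸m]≡n r<b)
    j<b : j < b
    j<b = subst (j <_) (sym b≡r+1+j) (s≤s (m≤n+m j r))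
    end : ∀ m → 3 + m + r * 2 ≡ suc m + suc r * 2
    end m = solve (m ∷ r ∷ [])
    z-split : ∀ {j} m b → b ≡ suc r + j → 1 + (m + 2 * b) + j * 2 ≡ 2 + j * 4 + (1 + m + r * 2)
    z-split {j} m _ refl = solve (m ∷ r ∷ j ∷ [])
    x-split : ∀ {j} m b → b ≡ suc r + j → 2 + (m + 2 * b) + j * 2 ≡ 2 + j * 4 + (2 + m + r * 2)
    x-split {j} m _ refl = solve (m ∷ r ∷ j ∷ [])

  squares-cover : Covers SquareLabel (suc t) (suc (t + 4 * (a + b)))
  squares-cover = subst (Covers SquareLabel (suc t)) end₃
    (subst (Covers SquareLabel (suc t)) end₁ (blocks 4 (suc t) a high-block)
     ⟫ subst (Covers SquareLabel (suc (t + 4 * a))) end₂ (blocks 2 (suc (t + 4 * a)) b low-inner-block)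
     ⟫ blocks 2 (suc middle) b low-rim-block)
    where
    end₁ : suc t + a * 4 ≡ suc (t + 4 * a)
    end₁ = solve (t ∷ a ∷ [])
    end₂ : suc (t + 4 * a) + b * 2 ≡ suc (t + 4 * a + 2 * b)
    end₂ = solve (t ∷ a ∷ b ∷ [])
    end₃ : suc (t + 4 * a + 2 * b) + b * 2 ≡ suc (t + 4 * (a + b))
    end₃ = solve (t ∷ a ∷ b ∷ [])

  high-y≤middle : ∀ j → j < a → yOf (high j) ≤ middle
  -- Adding 3 turns the left side into twice `t + 4 * suc j`; one copy is bounded through `a-small`,
  -- whose guard follows from `j < a`.
  high-y≤middle j j<a = +-cancelˡ-≤ 3 _ _ (begin
    3 + (5 + 2 * t + 2 * j * 4)     ≡⟨ solve (t ∷ j ∷ []) ⟩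
    t + 4 * suc j + (t + 4 * suc j)   ≤⟨ +-mono-≤ below-a (≤-trans below-a (a-small (≤-trans (s≤s z≤n) j<a))) ⟩
    t + 4 * a + (3 + 2 * b)           ≡⟨ solve (t ∷ a ∷ b ∷ []) ⟩
    3 + (t + 4 * a + 2 * b)           ∎)
    where
    open ≤-Reasoning
    below-a : t + 4 * suc j ≤ t + 4 * a
    below-a = +-monoʳ-≤ t (*-monoʳ-≤ 4 j<a)

  low-y≤middle : ∀ j → j < b → yOf (low j) ≤ middle
  low-y≤middle j j<b = +-cancelˡ-≤ 2 _ _ (begin
    2 + (2 + j * 4)            ≡⟨ solve (j ∷ []) ⟩
    2 * suc j + 2 * suc j      ≤⟨ +-mono-≤ (*-monoʳ-≤ 2 j<b) (*-monoʳ-≤ 2 j<b) ⟩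
    2 * b + 2 * b              ≤⟨ +-monoˡ-≤ (2 * b) b-small ⟩
    2 + (t + 4 * a) + 2 * b    ∎)
    where open ≤-Reasoning

  y≤middle : ∀ u → yOf (square u) ≤ middle
  y≤middle (inj₁ i) = high-y≤middle (toℕ i) (toℕ<n i)
  y≤middle (inj₂ i) = low-y≤middle (toℕ i) (toℕ<n i)

  middle≤ : middle ≤ t + 4 * (a + b)
  middle≤ = begin
    t + 4 * a + 2 * b              ≤⟨ m≤m+n _ (2 * b) ⟩
    t + 4 * a + 2 * b + 2 * b      ≡⟨ solve (t ∷ a ∷ b ∷ []) ⟩
    t + 4 * (a + b)                ∎
    where open ≤-Reasoning

  1≤y : ∀ u → 1 ≤ yOf (square u)
  1≤y (inj₁ i) = s≤s z≤n
  1≤y (inj₂ i) = s≤s z≤n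

  -- The rim of `low` lies above `middle`, hence above all opposite vertices; from the rim of `high`
  -- they differ modulo 4.
  sq-y≢x : ∀ u v → yOf (square u) ≢ xOf (square v)
  sq-y≢x u        (inj₂ k) eq = <⇒≢ (s≤s (≤-trans (y≤middle u) (≤-trans (m≤m+n middle _) (n≤1+n _)))) eq
  sq-y≢x (inj₁ i) (inj₁ k) = %4-≢ (5 + 2 * t) (2 + δ + t) (2 * toℕ i) (toℕ k) y≢x
  sq-y≢x (inj₂ i) (inj₁ k) = %4-≢ 2 (2 + δ + t) (toℕ i) (toℕ k) (x≢2 ∘ sym)

  sq-y≢z : ∀ u v → yOf (square u) ≢ zOf (square v)
  sq-y≢z u        (inj₂ k) eq = <⇒≢ (s≤s (≤-trans (y≤middle u) (m≤m+n middle _))) eq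
  sq-y≢z (inj₁ i) (inj₁ k) = %4-≢ (5 + 2 * t) (1 + δ + t) (2 * toℕ i) (toℕ k) y≢z
  sq-y≢z (inj₂ i) (inj₁ k) = %4-≢ 2 (1 + δ + t) (toℕ i) (toℕ k) (z≢2 ∘ sym)

  sq-y-injective : ∀ u v → yOf (square u) ≡ yOf (square v) → u ≡ v
  sq-y-injective (inj₁ i) (inj₁ k) eq = cong inj₁ (toℕ-injective (*-cancelˡ-≡ (toℕ i) (toℕ k) 2
    (*-cancelʳ-≡ _ _ 4 (+-cancelˡ-≡ (5 + 2 * t) _ _ eq))))
  sq-y-injective (inj₁ i) (inj₂ k) eq =
    contradiction eq (%4-≢ (5 + 2 * t) 2 (2 * toℕ i) (toℕ k) y≢2)
  sq-y-injective (inj₂ i) (inj₁ k) eq =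
    contradiction (sym eq) (%4-≢ (5 + 2 * t) 2 (2 * toℕ k) (toℕ i) y≢2)
  sq-y-injective (inj₂ i) (inj₂ k) eq =
    cong inj₂ (toℕ-injective (*-cancelʳ-≡ _ _ 4 (+-cancelˡ-≡ 2 _ _ eq)))

-- The two inequalities say that no opposite vertex exceeds t + 4a + 2b, above which lie the
-- rim labels of the squares `low`.
balance : ∀ t s → ∃₂ λ a b → a + b ≡ s × 2 * b ≤ 2 + (t + 4 * a) × (0 < a → t + 4 * a ≤ 3 + 2 * b)
balance t zero = 0 , 0 , refl , z≤n , λ ()
balance t (suc s) with balance t s
-- Greedy choice: the new square joins `low` if `b-small` survives. Otherwise that failure is just
-- the bound `a-small` for `suc a`.
... | a , b , refl , b-small , a-small with 2 * suc b ≤? 2 + (t + 4 * a)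
... | yes b+1-small = a , suc b , +-suc a b , b+1-small ,
  λ 0<a → ≤-trans (a-small 0<a) (+-monoʳ-≤ 3 (*-monoʳ-≤ 2 (n≤1+n b)))
... | no  b+1-large = suc a , b , refl , ≤-trans b-small (+-monoʳ-≤ 2 (+-monoʳ-≤ t (*-monoʳ-≤ 4 (n≤1+n a)))) ,
  λ _ → a+1-small
  where
  a+1-small : t + 4 * suc a ≤ 3 + 2 * b
  a+1-small = begin
    t + 4 * suc a            ≡⟨ solve (t ∷ a ∷ []) ⟩
    1 + (3 + (t + 4 * a))    ≤⟨ s≤s (≰⇒> b+1-large) ⟩
    1 + 2 * suc b            ≡⟨ solve (b ∷ []) ⟩
    3 + 2 * b                ∎
    where open ≤-Reasoning

-- Triangles and 4-cycles together

module Windmill (ts : Pairs) (offset : Offset (length ts)) (a b : ℕ)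
                (b-small : 2 * b ≤ 2 + (length ts + 4 * a))
                (a-small : 0 < a → length ts + 4 * a ≤ 3 + 2 * b) where

  t s top : ℕ
  t = length ts
  s = a + b
  top = t + 4 * s

  open Squares t offset a b b-small a-small

  vanes : Vanes t s
  vanes = record
    -- Places count from 0 and labels above `top` from `suc top`, hence the `suc`.
    { p = λ i → suc (top + proj₁ (lookup ts i))
    ; q = λ i → suc (top + (proj₁ (lookup ts i) + proj₂ (lookup ts i)))
    ; x = xOf ∘ square ∘ splitAt a
    ; y = yOf ∘ square ∘ splitAt a
    ; z = zOf ∘ square ∘ splitAt a
    }

  f : Vert t s → ℕ
  f = labelling vanes

  attain-distance : ∀ {k} → HasDistance ts k → Attained f k
  attain-distance d = triE (index d) (suc zero) ,
    trans (∣n-m∣≡d _ _ _ (cong suc (sym (+-assoc top _ _)))) (lookup-index d)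

  attain-place : ∀ {k} → HasPlace ts k → Attained f (suc (top + k))
  attain-place d with lookup-index d
  ... | inj₁ start = triE (index d) zero , cong (λ m → suc (top + m)) start
  ... | inj₂ end   = triE (index d) (suc (suc zero)) , cong (λ m → suc (top + m)) end

  attain-square : ∀ {k} → SquareLabel k → Attained f k
  attain-square {k} (u , l) = edge (subst (λ v → HasLabel (square v) k) (sym (splitAt-join a b u)) l)
    where
    edge : HasLabel (square (splitAt a (join a b u))) k → Attained f k
    edge (x-label eq)  = sqE (join a b u) zero , eq
    edge (xy-label eq) = sqE (join a b u) (suc zero) , eq
    edge (yz-label eq) = sqE (join a b u) (suc (suc zero)) , eq
    edge (z-label eq)  = sqE (join a b u) (suc (suc (suc zero))) , trans (∣-∣-identityʳ _) eq

  separated : ∀ {bound} → top ≤ bound → OppositesSeparated vanes bound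
  separated top≤bound = record
    { y-injective = λ {i} {j} eq → trans (sym (join-splitAt a b i))
        (trans (cong (join a b) (sq-y-injective (splitAt a i) (splitAt a j) eq)) (join-splitAt a b j))
    ; y≥1     = λ j → 1≤y (splitAt a j)
    ; y≤bound = λ j → ≤-trans (y≤top j) top≤bound
    ; y≢p     = λ j i → <⇒≢ (s≤s (≤-trans (y≤top j) (m≤m+n top _)))
    ; y≢q     = λ j i → <⇒≢ (s≤s (≤-trans (y≤top j) (m≤m+n top _)))
    ; y≢x     = λ j i → sq-y≢x (splitAt a j) (splitAt a i)
    ; y≢z     = λ j i → sq-y≢z (splitAt a j) (splitAt a i)
    }
    where
    y≤top : ∀ j → Vanes.y vanes j ≤ top
    y≤top j = ≤-trans (y≤middle (splitAt a j)) middle≤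

  edges≡ : edges t s ≡ top + 2 * t
  edges≡ = shape t s
    where
    shape : ∀ t s → 3 * t + 4 * s ≡ t + 4 * s + 2 * t
    shape t s = solve (t ∷ s ∷ [])

  top≤edges : top ≤ edges t s
  top≤edges = subst (top ≤_) (sym edges≡) (m≤m+n top (2 * t))

  module _ (distance : ∀ k → k < t → HasDistance ts (suc k)) where

    attain-≤top : ∀ k → 1 ≤ k → k ≤ top → Attained f k
    attain-≤top (suc k) _ k<top with k <? t
    ... | yes k<t = attain-distance (distance k k<t)
    ... | no  k≮t = attain-square (covered squares-cover (s≤s (≮⇒≥ k≮t)) (s≤s k<top))

    -- Abstract in `P`, so that the graceful and the hooked range share the argument.
    attain : ∀ {P : ℕ → Set} → (∀ {k} → P k → 1 ≤ k) → (∀ k → P (suc (top + k)) → HasPlace ts k) →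
             ∀ k → P k → Attained f k
    attain P⇒≥1 place k Pk with k ≤? top
    ... | yes k≤top = attain-≤top k (P⇒≥1 Pk) k≤top
    ... | no  k≰top with i , refl ← m≤n⇒∃[o]m+o≡n (≰⇒> k≰top) = attain-place (place i Pk)

    graceful : (∀ k → k < 2 * t → HasPlace ts k) → Graceful t s
    graceful place = f , isLabelling vanes proj₁ proj₂ (enumerates-Range1 (edges t s))
      (attain proj₁ λ k (_ , k<M) → place k (+-cancelˡ-< top _ _ (subst (suc (top + k) ≤_) edges≡ k<M)))
      (separated top≤edges)

    -- Place k carries the label top + 1 + k, so the hook omits the label `edges t s` and the last
    -- place carries its successor.
    nearGraceful : (∀ k → suc k < 2 * t ⊎ k ≡ 2 * t → HasPlace ts k) → NearGraceful t s
    nearGraceful place = f , inj₂ (isLabelling vanes ≥1 ≤M+1 (enumerates-Range1′ (edges t s))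
      (attain ≥1 hooked-place) (separated (m≤n⇒m≤1+n top≤edges)))
      where
      ≥1 : ∀ {k} → Range1' (edges t s) k → 1 ≤ k
      ≥1 (inj₁ (1≤k , _)) = 1≤k
      ≥1 (inj₂ refl)      = s≤s z≤n

      ≤M+1 : ∀ {k} → Range1' (edges t s) k → k ≤ suc (edges t s)
      ≤M+1 (inj₁ (_ , k≤M∸1)) = ≤-trans k≤M∸1 (≤-trans (m∸n≤m (edges t s) 1) (n≤1+n _))
      ≤M+1 (inj₂ refl)        = ≤-refl

      <∸1⇒suc< : ∀ {m} n → m < n ∸ 1 → suc m < n
      <∸1⇒suc< (suc n) = s≤s

      hooked-place : ∀ k → Range1' (edges t s) (suc (top + k)) → HasPlace ts k
      hooked-place k (inj₁ (_ , k<M∸1)) = place k (inj₁ (+-cancelˡ-< top _ _ (subst (_< top + 2 * t) (sym (+-suc top k))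
        (subst (suc (top + k) <_) edges≡ (<∸1⇒suc< (edges t s) k<M∸1)))))
      hooked-place k (inj₂ eq) = place k (inj₂ (+-cancelˡ-≡ top _ _ (trans (suc-injective eq) edges≡)))

-- Assembling the cases by the residue of `t` modulo 4

skolem⇒graceful : ∀ {t} s → Offset t → Skolem t → Graceful t s
skolem⇒graceful s offset (ts , refl , distance , place)
  with a , b , refl , b-small , a-small ← balance (length ts) s =
  Windmill.graceful ts offset a b b-small a-small distance place

hookedSkolem⇒nearGraceful : ∀ {t} s → Offset t → HookedSkolem t → NearGraceful t s
hookedSkolem⇒nearGraceful s offset (ts , refl , distance , place)
  with a , b , refl , b-small , a-small ← balance (length ts) s =
  Windmill.nearGraceful ts offset a b b-small a-small distance place

offset-+ : ∀ w {z} → Offset z → Offset (4 * w + z)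
offset-+ w {z} o = record
  { δ     = δ
  ; δ-0-2 = δ-0-2
  ; x≢2   = x≢2 ∘ trans (sym (shift (2 + δ)))
  ; z≢2   = z≢2 ∘ trans (sym (shift (1 + δ)))
  ; y≢2   = y≢2 ∘ trans (sym double-shift)
  ; y≢x   = λ eq → y≢x (trans (sym double-shift) (trans eq (shift (2 + δ))))
  ; y≢z   = λ eq → y≢z (trans (sym double-shift) (trans eq (shift (1 + δ))))
  }
  where
  open Offset o
  shift : ∀ c → (c + (4 * w + z)) % 4 ≡ (c + z) % 4
  shift c = trans (cong (_% 4) eq) ([m+kn]%n≡m%n (c + z) w 4)
    where
    eq : c + (4 * w + z) ≡ c + z + w * 4
    eq = solve (c ∷ w ∷ z ∷ [])
  double-shift : (5 + 2 * (4 * w + z)) % 4 ≡ (5 + 2 * z) % 4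
  double-shift = trans (cong (_% 4) eq) ([m+kn]%n≡m%n (5 + 2 * z) (2 * w) 4)
    where
    eq : 5 + 2 * (4 * w + z) ≡ 5 + 2 * z + 2 * w * 4
    eq = solve (w ∷ z ∷ [])

-- In these four, the rim residues are 0 and 3 for even `t`, 0 and 1 for odd `t`; the opposite
-- residue is 1 and 3 respectively.
offset₀ : Offset 0
offset₀ = record { δ = 2 ; δ-0-2 = inj₂ refl ; x≢2 = λ () ; z≢2 = λ () ; y≢2 = λ () ; y≢x = λ () ; y≢z = λ () }

offset₁ : Offset 1
offset₁ = record { δ = 2 ; δ-0-2 = inj₂ refl ; x≢2 = λ () ; z≢2 = λ () ; y≢2 = λ () ; y≢x = λ () ; y≢z = λ () }

offset₂ : Offset 2
offset₂ = record { δ = 0 ; δ-0-2 = inj₁ refl ; x≢2 = λ () ; z≢2 = λ () ; y≢2 = λ () ; y≢x = λ () ; y≢z = λ () }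

offset₃ : Offset 3
offset₃ = record { δ = 0 ; δ-0-2 = inj₁ refl ; x≢2 = λ () ; z≢2 = λ () ; y≢2 = λ () ; y≢x = λ () ; y≢z = λ () }

theorem4p4 : (s t w z : ℕ) → z ≤ 3 → t ≡ 4 * w + z →
    ((z ≡ 0 ⊎ z ≡ 1) → Graceful t s)
    × ((z ≡ 2 ⊎ z ≡ 3) → NearGraceful t s)
theorem4p4 s _ w z _ refl = (λ where
      (inj₁ refl) → skolem⇒graceful s (offset-+ w offset₀) (skolem-4w w)
      (inj₂ refl) → skolem⇒graceful s (offset-+ w offset₁) (skolem-4w+1 w))
  , (λ where
      (inj₁ refl) → hookedSkolem⇒nearGraceful s (offset-+ w offset₂) (hookedSkolem-4w+2 w)
      (inj₂ refl) → hookedSkolem⇒nearGraceful s (offset-+ w offset₃) (hookedSkolem-4w+3 w))
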